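{- Let $\mathcal{C}$ be a nondegenerate $[n,k]_{q^m/q}$ code and let $w^{\mathrm{rk}}(\mathcal{C})$ be the maximum rank of a codeword of $\mathcal{C}$. Then $w^{\mathrm{rk}}(\mathcal{C})=\min\{n,m\}$. In particular, if $n=m$, then an $[n,k]_{q^n/q}$ code $\mathcal{C}$ is nondegenerate if and only if $w^{\mathrm{rk}}(\mathcal{C})=n$.
   Context: Let $q$ be a prime power and $n,m,k$ positive integers. For $v\in\mathbb{F}_{q^m}^n$ and an ordered basis $\Gamma=(\gamma_1,\dots,\gamma_m)$ of $\mathbb{F}_{q^m}$ over $\mathbb{F}_q$, let $\Gamma(v)\in\mathbb{F}_q^{n\times m}$ be the matrix with $v_i=\sum_{j=1}^m\Gamma(v)_{ij}\gamma_j$. The rank support $\sigma^{\mathrm{rk}}(v)\subseteq\mathbb{F}_q^n$ is the column space of $\Gamma(v)$ (it does not depend on $\Gamma$), and the rank of $v$ is $\mathrm{rk}(v)=\dim_{\mathbb{F}_q}\sigma^{\mathrm{rk}}(v)$. An $[n,k]_{q^m/q}$ code is a $k$-dimensional $\mathbb{F}_{q^m}$-subspace $\mathcal{C}\subseteq\mathbb{F}_{q^m}^n$; its elements are called codewords. Its rank support is $\sigma^{\mathrm{rk}}(\mathcal{C})=\sum_{v\in\mathcal{C}}\sigma^{\mathrm{rk}}(v)$, and $\mathcal{C}$ is (rank-)nondegenerate if $\sigma^{\mathrm{rk}}(\mathcal{C})=\mathbb{F}_q^n$. -}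

module Defs where

open import Algebra.Bundles using (CommutativeRing; Ring)
open import Algebra.Module.Bundles using (LeftModule)
import Algebra.Module.Construct.TensorUnit as TensorUnit
open import Algebra.Morphism.Structures using (IsRingHomomorphism)
import Algebra.Properties.Monoid.Sum as Sum
open import Data.Fin.Base using (Fin)
open import Data.Nat.Base using (ℕ; _^_; _≤_; _<_)
open import Data.Nat.Primality using (Prime)
open import Data.Product.Base using (Σ; ∃; ∃₂; _×_; _,_; proj₁)
open import Data.Unit.Base using (tt)
open import Data.Vec.Functional using (Vector)
open import Function.Bundles using (Inverse)
open import Level using (Level; _⊔_; suc; 0ℓ)
open import Relation.Binary.PropositionalEquality using (_≡_; setoid)
open import Relation.Nullary.Negation.Core using (¬_)
open import Relation.Unary using (Pred; _∈_; _⊆_; U)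

IsPrimePower : ℕ → Set
IsPrimePower q = ∃₂ λ p e → Prime p × 0 < e × q ≡ p ^ e

IsMaximum : ∀ {p} → Pred ℕ p → ℕ → Set p
IsMaximum P w = P w × (∀ {r} → P r → r ≤ w)

record FiniteField (c ℓ : Level) (q : ℕ) : Set (suc (c ⊔ ℓ)) where
  field
    commutativeRing : CommutativeRing c ℓ
  open CommutativeRing commutativeRing public renaming (setoid to ≈-setoid)
  field
    1≉0         : ¬ (1# ≈ 0#)
    inverse     : ∀ x → ¬ (x ≈ 0#) → ∃ λ y → x * y ≈ 1#
    cardinality : Inverse ≈-setoid (setoid (Fin q))

-- A homomorphism of fields is automatically injective.
record Extension {a ℓa b ℓb : Level} {q r : ℕ}
                 (K : FiniteField a ℓa q) (L : FiniteField b ℓb r)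
                 : Set (a ⊔ ℓa ⊔ b ⊔ ℓb) where
  private
    module K = FiniteField K
    module L = FiniteField L
  field
    ι                  : K.Carrier → L.Carrier
    isRingHomomorphism : IsRingHomomorphism K.rawRing L.rawRing ι
  open IsRingHomomorphism isRingHomomorphism public

power : ∀ {r ℓr v ℓv} {R : Ring r ℓr} → LeftModule R v ℓv → ℕ → LeftModule R v ℓv
power M n = record
  { Carrierᴹ     = Vector Carrierᴹ n
  ; _≈ᴹ_         = λ x y → ∀ i → x i ≈ᴹ y i
  ; _+ᴹ_         = λ x y i → x i +ᴹ y i
  ; _*ₗ_         = λ a x i → a *ₗ x i
  ; 0ᴹ           = λ _ → 0ᴹ
  ; -ᴹ_          = λ x i → -ᴹ x i
  ; isLeftModule = record
    { isLeftSemimodule = record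
      { +ᴹ-isCommutativeMonoid = record
        { isMonoid = record
          { isSemigroup = record
            { isMagma = record
              { isEquivalence = record
                { refl  = λ _ → ≈ᴹ-refl
                ; sym   = λ p i → ≈ᴹ-sym (p i)
                ; trans = λ p q i → ≈ᴹ-trans (p i) (q i)
                }
              ; ∙-cong = λ p q i → +ᴹ-cong (p i) (q i)
              }
            ; assoc = λ x y z i → +ᴹ-assoc (x i) (y i) (z i)
            }
          ; identity = (λ x i → +ᴹ-identityˡ (x i)) , (λ x i → +ᴹ-identityʳ (x i))
          }
        ; comm = λ x y i → +ᴹ-comm (x i) (y i)
        }
      ; isPreleftSemimodule = record
        { *ₗ-cong      = λ p q i → *ₗ-cong p (q i)
        ; *ₗ-zeroˡ     = λ x i → *ₗ-zeroˡ (x i)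
        ; *ₗ-distribʳ  = λ x a b i → *ₗ-distribʳ (x i) a b
        ; *ₗ-identityˡ = λ x i → *ₗ-identityˡ (x i)
        ; *ₗ-assoc     = λ a b x i → *ₗ-assoc a b (x i)
        ; *ₗ-zeroʳ     = λ a i → *ₗ-zeroʳ a
        ; *ₗ-distribˡ  = λ a x y i → *ₗ-distribˡ a (x i) (y i)
        }
      }
    ; -ᴹ‿cong    = λ p i → -ᴹ‿cong (p i)
    ; -ᴹ‿inverse = (λ x i → -ᴹ‿inverseˡ (x i)) , (λ x i → -ᴹ‿inverseʳ (x i))
    }
  }
  where open LeftModule M

coordinateSpace : ∀ {c ℓ q} (F : FiniteField c ℓ q) (n : ℕ) → LeftModule (FiniteField.ring F) c ℓ
coordinateSpace F = power (TensorUnit.leftModule {R = FiniteField.ring F})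

overBase : ∀ {a ℓa b ℓb q r} {K : FiniteField a ℓa q} {L : FiniteField b ℓb r} →
           Extension K L → LeftModule (FiniteField.ring K) b ℓb
overBase {K = K} {L = L} E = record
  { Carrierᴹ     = L.Carrier
  ; _≈ᴹ_         = L._≈_
  ; _+ᴹ_         = L._+_
  ; _*ₗ_         = λ a x → ι a L.* x
  ; 0ᴹ           = L.0#
  ; -ᴹ_          = L.-_
  ; isLeftModule = record
    { isLeftSemimodule = record
      { +ᴹ-isCommutativeMonoid = L.+-isCommutativeMonoid
      ; isPreleftSemimodule = record
        { *ₗ-cong      = λ p q → L.*-cong (⟦⟧-cong p) q
        ; *ₗ-zeroˡ     = λ x → L.trans (L.*-congʳ 0#-homo) (L.zeroˡ x)
        ; *ₗ-distribʳ  = λ x a b → L.trans (L.*-congʳ (+-homo a b)) (L.distribʳ x (ι a) (ι b))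
        ; *ₗ-identityˡ = λ x → L.trans (L.*-congʳ 1#-homo) (L.*-identityˡ x)
        ; *ₗ-assoc     = λ a b x → L.trans (L.*-congʳ (*-homo a b)) (L.*-assoc (ι a) (ι b) x)
        ; *ₗ-zeroʳ     = λ a → L.zeroʳ (ι a)
        ; *ₗ-distribˡ  = λ a x y → L.distribˡ (ι a) x y
        }
      }
    ; -ᴹ‿cong    = L.-‿cong
    ; -ᴹ‿inverse = L.-‿inverse
    }
  }
  where
  module L = FiniteField L
  open Extension E

module LinearAlgebra {r ℓr v ℓv : Level} {R : Ring r ℓr} (V : LeftModule R v ℓv) where
  open Ring R using (Carrier; _≈_; 0#)
  open LeftModule V
  open Sum +ᴹ-monoid using (sum)

  combination : ∀ {d} → Vector Carrier d → Vector Carrierᴹ d → Carrierᴹ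
  combination a x = sum λ i → a i *ₗ x i

  Span : ∀ {d} → Vector Carrierᴹ d → Pred Carrierᴹ (r ⊔ ℓv)
  Span x y = ∃ λ a → y ≈ᴹ combination a x

  LinearlyIndependent : ∀ {d} → Vector Carrierᴹ d → Set (r ⊔ ℓr ⊔ ℓv)
  LinearlyIndependent x = ∀ a → combination a x ≈ᴹ 0ᴹ → ∀ i → a i ≈ 0#

  record IsSubspace {p : Level} (W : Pred Carrierᴹ p) : Set (r ⊔ v ⊔ ℓv ⊔ p) where
    field
      resp-≈     : ∀ {x y} → x ≈ᴹ y → x ∈ W → y ∈ W
      0-closed   : 0ᴹ ∈ W
      +-closed   : ∀ {x y} → x ∈ W → y ∈ W → x +ᴹ y ∈ W
      *ₗ-closed  : ∀ a {x} → x ∈ W → a *ₗ x ∈ W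

  record IsBasis {p : Level} (W : Pred Carrierᴹ p) {d : ℕ} (x : Vector Carrierᴹ d)
                 : Set (r ⊔ ℓr ⊔ v ⊔ ℓv ⊔ p) where
    field
      members     : ∀ i → x i ∈ W
      independent : LinearlyIndependent x
      spanning    : W ⊆ Span x

  HasDimension : ∀ {p} → Pred Carrierᴹ p → ℕ → Set (r ⊔ ℓr ⊔ v ⊔ ℓv ⊔ p)
  HasDimension W d = ∃ λ (x : Vector Carrierᴹ d) → IsBasis W x

  -- The sum of an arbitrary family of subspaces: all finite sums of
  -- elements of its members.
  FamilySum : ∀ {i p} {I : Set i} → (I → Pred Carrierᴹ p) → Pred Carrierᴹ (i ⊔ v ⊔ ℓv ⊔ p)
  FamilySum {I = I} W y =
    ∃ λ s → ∃₂ λ (j : Vector I s) (x : Vector Carrierᴹ s) →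
      (∀ t → x t ∈ W (j t)) × y ≈ᴹ sum x

record OrderedBasis {a ℓa b ℓb : Level} {q r : ℕ}
                    {K : FiniteField a ℓa q} {L : FiniteField b ℓb r}
                    (E : Extension K L) (m : ℕ) : Set (a ⊔ ℓa ⊔ b ⊔ ℓb) where
  private module L = FiniteField L
  field
    γ       : Vector L.Carrier m
    isBasis : LinearAlgebra.IsBasis (overBase E) {p = 0ℓ} U γ

record Code {b ℓb : Level} {r : ℕ} (L : FiniteField b ℓb r) (n k : ℕ) (p : Level)
            : Set (b ⊔ ℓb ⊔ suc p) where
  open LinearAlgebra (coordinateSpace L n)
  field
    Codeword     : Pred (Vector (FiniteField.Carrier L) n) p
    isSubspace   : IsSubspace Codeword
    hasDimension : HasDimension Codeword k

module RankMetric {a ℓa b ℓb : Level} {q r m : ℕ}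
                  {K : FiniteField a ℓa q} {L : FiniteField b ℓb r}
                  {E : Extension K L} (Γ : OrderedBasis E m) where
  private
    module K = FiniteField K
    module L = FiniteField L
  open OrderedBasis Γ

  -- coordinates v i j is the coefficient of γ j in v i.
  coordinates : ∀ {n} → Vector L.Carrier n → Fin n → Fin m → K.Carrier
  coordinates v i = proj₁ (LinearAlgebra.IsBasis.spanning isBasis {x = v i} tt)

  module _ {n : ℕ} where
    open LinearAlgebra (coordinateSpace K n)

    columnSpace : (Fin n → Fin m → K.Carrier) → Pred (Vector K.Carrier n) (a ⊔ ℓa)
    columnSpace A = Span λ j i → A i j

    rankSupport : Vector L.Carrier n → Pred (Vector K.Carrier n) (a ⊔ ℓa)
    rankSupport v = columnSpace (coordinates v)

    -- Dimension is the relation "has a basis of d elements", so rank is a relation too.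
    HasRank : Vector L.Carrier n → ℕ → Set (a ⊔ ℓa)
    HasRank v = HasDimension (rankSupport v)

    module _ {k : ℕ} {p : Level} (C : Code L n k p) where
      open Code C

      codeRankSupport : Pred (Vector K.Carrier n) (a ⊔ ℓa ⊔ b ⊔ p)
      codeRankSupport = FamilySum {I = Σ (Vector L.Carrier n) Codeword} λ c → rankSupport (proj₁ c)

      Nondegenerate : Set (a ⊔ ℓa ⊔ b ⊔ p)
      Nondegenerate = ∀ x → x ∈ codeRankSupport

      IsMaximumRank : ℕ → Set (a ⊔ ℓa ⊔ b ⊔ p)
      IsMaximumRank = IsMaximum λ w → ∃ λ v → v ∈ Codeword × HasRank v w

{-# OPTIONS --safe #-}
module Submission where

-- Let v be a codeword and Y a family of s < m vectors of Kⁿ whose products with v are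
-- independent over K. Either v itself is independent, or some nonzero y ∈ Kⁿ annihilates
-- v, and by nondegeneracy some codeword w has y · w ≠ 0. A nonzero c ∈ Kˢ⁺¹ is a
-- relation between the products of y ∷ Y with v + α w for at most one α ∈ L, and
-- qˢ⁺¹ − 1 < qᵐ, so for some α the larger family is independent on v + α w.
-- Iterating reaches rank min(n, m), which bounds every rank.

open import Algebra.Bundles using (CommutativeRing; Ring)
open import Algebra.Module.Bundles using (LeftModule)
import Algebra.Module.Construct.TensorUnit as TensorUnit
open import Algebra.Module.Morphism.Structures using (module LeftSemimoduleMorphisms)
import Algebra.Properties.CommutativeMonoid.Sum as CommutativeSum
import Algebra.Properties.Group as GroupProperties
import Algebra.Properties.Ring as RingProperties
open import Data.Fin.Base using (Fin; zero; suc; combine; finToFun; funToFin)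
open import Data.Fin.Properties
  using (all?; any?; ¬∀⟶∃¬; finToFun-funToFin; funToFin-finToFin; injective⇒≤)
  renaming (_≟_ to _≟ᶠ_)
open import Data.Nat.Base using (ℕ; zero; suc; _^_; _≤_; _<_; _⊓_; z≤n; >-nonZero)
open import Data.Nat.Properties
  using (≤-antisym; ≤-refl; ≤-trans; <⇒≤; <⇒≱; ≮⇒≥; m≤n⇒m<n∨m≡n; ^-monoʳ-≤; ^-monoʳ-<;
         ⊓-glb; ⊓-idem; m⊓n≤m; m⊓n≤n; n<1+n)
open import Data.Product.Base using (∃; _×_; _,_; proj₁; proj₂)
open import Data.Sum.Base using (_⊎_; inj₁; inj₂)
open import Data.Vec.Functional using (Vector; _∷_)
open import Function.Base using (_∘_)
open import Function.Bundles using (_⇔_; mk⇔; Inverse)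
open import Function.Definitions using (Injective)
open import Level using (Level; _⊔_)
open import Relation.Binary.Definitions using () renaming (Decidable to Decidable₂)
open import Relation.Binary.PropositionalEquality as ≡ using (_≡_; refl; cong; subst)
import Relation.Binary.Reasoning.Setoid as SetoidReasoning
open import Relation.Nullary.Decidable using (Dec; yes; no; map′; _×-dec_; ¬?; decidable-stable)
open import Relation.Nullary.Negation.Core using (¬_; contradiction)
open import Relation.Unary using (Pred; _∈_; _⊆_; Decidable)
open import Defs

private
  variable
    a ℓa b ℓb p r ℓr v ℓv w ℓw : Level
    q n m k d e s : ℕ

-- Numbering the functions between finite sets.

funToFin-cong : {f g : Fin m → Fin n} → (∀ i → f i ≡ g i) → funToFin f ≡ funToFin g
funToFin-cong {m = zero}  f≗g = refl
funToFin-cong {m = suc m} f≗g =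
  ≡.cong₂ combine (f≗g zero) (funToFin-cong (f≗g ∘ suc))

finToFun-injective : {i j : Fin (n ^ m)} → (∀ t → finToFun {n} {m} i t ≡ finToFun j t) → i ≡ j
finToFun-injective {n} {m} {i} {j} i≗j = begin
  i                              ≡⟨ funToFin-finToFin {m} i ⟨
  funToFin (finToFun {n} {m} i)  ≡⟨ funToFin-cong {f = finToFun {n} {m} i} {g = finToFun j} i≗j ⟩
  funToFin (finToFun {n} {m} j)  ≡⟨ funToFin-finToFin {m} j ⟩
  j                              ∎
  where open ≡.≡-Reasoning

-- For the ring of a finite field this unfolds to `coordinateSpace`; it serves as the space of
-- coefficient vectors.
free : (R : Ring r ℓr) → ℕ → LeftModule R r ℓr
free R = power (TensorUnit.leftModule {R = R})

-- The standard basis of the free module.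
δ : (R : Ring r ℓr) → Fin d → Vector (Ring.Carrier R) d
δ R zero    = Ring.1# R ∷ λ _ → Ring.0# R
δ R (suc i) = Ring.0# R ∷ δ R i

-- Linear maps and linear combinations over a ring.

record IsLinear {R : Ring r ℓr} (V : LeftModule R v ℓv) (W : LeftModule R w ℓw)
                (f : LeftModule.Carrierᴹ V → LeftModule.Carrierᴹ W) : Set (r ⊔ v ⊔ ℓv ⊔ ℓw) where
  private
    module V = LeftModule V
    module W = LeftModule W
    module LV = LinearAlgebra V
    module LW = LinearAlgebra W
  open LeftSemimoduleMorphisms V.rawLeftSemimodule W.rawLeftSemimodule
  field
    isLeftSemimoduleHomomorphism : IsLeftSemimoduleHomomorphism f
  open IsLeftSemimoduleHomomorphism isLeftSemimoduleHomomorphism public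

  combination-homo : ∀ (c : Vector _ d) x → f (LV.combination c x) W.≈ᴹ LW.combination c (f ∘ x)
  combination-homo {d = zero}  c x = 0ᴹ-homo
  combination-homo {d = suc d} c x =
    W.≈ᴹ-trans (+ᴹ-homo _ _)
      (W.+ᴹ-cong (*ₗ-homo _ _) (combination-homo (c ∘ suc) (x ∘ suc)))

  -ᴹ-homo : ∀ x → f (V.-ᴹ x) W.≈ᴹ W.-ᴹ f x
  -ᴹ-homo x = GroupProperties.inverseʳ-unique W.+ᴹ-group _ _
    (W.≈ᴹ-trans (W.≈ᴹ-sym (+ᴹ-homo x (V.-ᴹ x)))
      (W.≈ᴹ-trans (⟦⟧-cong (V.-ᴹ‿inverseʳ x)) 0ᴹ-homo))

module _ {R : Ring r ℓr} (V : LeftModule R v ℓv) (W : LeftModule R w ℓw) where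
  private
    module R = Ring R
    module V = LeftModule V
    module W = LeftModule W

  isLinear : ∀ {f} →
             (∀ {x y} → x V.≈ᴹ y → f x W.≈ᴹ f y) →
             (∀ x y → f (x V.+ᴹ y) W.≈ᴹ f x W.+ᴹ f y) →
             (∀ c x → f (c V.*ₗ x) W.≈ᴹ c W.*ₗ f x) →
             IsLinear V W f
  isLinear {f} f-cong f-+ f-* = record
    { isLeftSemimoduleHomomorphism = record
      { +ᴹ-isMonoidHomomorphism = record
        { isMagmaHomomorphism = record
          { isRelHomomorphism = record { cong = f-cong }
          ; homo              = f-+
          }
        ; ε-homo = begin
            f V.0ᴹ               ≈⟨ f-cong (V.*ₗ-zeroˡ V.0ᴹ) ⟨
            f (R.0# V.*ₗ V.0ᴹ)   ≈⟨ f-* R.0# V.0ᴹ ⟩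
            R.0# W.*ₗ f V.0ᴹ     ≈⟨ W.*ₗ-zeroˡ (f V.0ᴹ) ⟩
            W.0ᴹ                 ∎
        }
      ; *ₗ-homo = f-*
      }
    }
    where open SetoidReasoning W.≈ᴹ-setoid

module Combination {R : Ring r ℓr} (V : LeftModule R v ℓv) where
  open Ring R using (Carrier; _≈_; 0#; 1#)
  open LeftModule V
  open LinearAlgebra V
  open CommutativeSum +ᴹ-commutativeMonoid using (sum-cong-≋; ∑-distrib-+)
  open SetoidReasoning ≈ᴹ-setoid

  combination-cong : ∀ {c c′ : Vector Carrier d} {x x′} → (∀ i → c i ≈ c′ i) →
                     (∀ i → x i ≈ᴹ x′ i) → combination c x ≈ᴹ combination c′ x′
  combination-cong c≈c′ x≈x′ = sum-cong-≋ λ i → *ₗ-cong (c≈c′ i) (x≈x′ i)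

  combination-isLinearˡ : (x : Vector Carrierᴹ d) →
                          IsLinear (free R d) V λ c → combination c x
  combination-isLinearˡ x = isLinear (free R _) V
    (λ c≈c′ → combination-cong c≈c′ λ _ → ≈ᴹ-refl)
    (λ c c′ → ≈ᴹ-trans (sum-cong-≋ λ i → *ₗ-distribʳ (x i) (c i) (c′ i))
      (∑-distrib-+ (λ i → c i *ₗ x i) (λ i → c′ i *ₗ x i)))
    (λ c c′ → homogeneous c c′ x)
    where
    homogeneous : ∀ c (c′ : Vector Carrier d) x →
                  combination (λ i → Ring._*_ R c (c′ i)) x ≈ᴹ c *ₗ combination c′ x
    homogeneous {zero}  c c′ x = ≈ᴹ-sym (*ₗ-zeroʳ c)
    homogeneous {suc d} c c′ x =
      ≈ᴹ-trans (+ᴹ-cong (*ₗ-assoc c _ _) (homogeneous c (c′ ∘ suc) (x ∘ suc)))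
               (≈ᴹ-sym (*ₗ-distribˡ c _ _))

  combination-zeroˡ : (x : Vector Carrierᴹ d) → combination (λ _ → 0#) x ≈ᴹ 0ᴹ
  combination-zeroˡ x = IsLinear.0ᴹ-homo (combination-isLinearˡ x)

  combination-δ : ∀ (i : Fin d) x → combination (δ R i) x ≈ᴹ x i
  combination-δ zero x =
    ≈ᴹ-trans (+ᴹ-cong (*ₗ-identityˡ _) (combination-zeroˡ (x ∘ suc))) (+ᴹ-identityʳ _)
  combination-δ (suc i) x =
    ≈ᴹ-trans (+ᴹ-cong (*ₗ-zeroˡ _) (combination-δ i (x ∘ suc))) (+ᴹ-identityˡ _)

  -- Associativity of the matrix product of a row `c`, a matrix `y` and a column `x`; it is
  -- linearity of `combination` in its coefficients, applied to `y`.
  combination-assoc : ∀ (c : Vector Carrier d) (y : Vector (Vector Carrier e) d) x →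
                      combination (LinearAlgebra.combination (free R e) c y) x ≈ᴹ
                      combination c λ i → combination (y i) x
  combination-assoc c y x = IsLinear.combination-homo (combination-isLinearˡ x) c y

  evaluation-isLinear : (i : Fin n) → IsLinear (power V n) V λ x → x i
  evaluation-isLinear i = isLinear (power V _) V (λ x≈y → x≈y i) (λ _ _ → ≈ᴹ-refl) λ _ _ → ≈ᴹ-refl

  ∈-Span : ∀ (x : Vector Carrierᴹ d) i → x i ∈ Span x
  ∈-Span x i = δ R i , ≈ᴹ-sym (combination-δ i x)

  Span-mono : ∀ (x : Vector Carrierᴹ d) (y : Vector Carrierᴹ e) →
              (∀ i → x i ∈ Span y) → Span x ⊆ Span y
  Span-mono x y x∈ {z} (c , z≈) = _ , (begin
    z                                                       ≈⟨ z≈ ⟩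
    combination c x                                         ≈⟨ combination-cong (λ _ → Ring.refl R) (proj₂ ∘ x∈) ⟩
    combination c (λ i → combination (proj₁ (x∈ i)) y)      ≈⟨ combination-assoc c (proj₁ ∘ x∈) y ⟨
    combination (LinearAlgebra.combination (free R _) c (proj₁ ∘ x∈)) y ∎)

  independent-resp-≈ : ∀ {x y : Vector Carrierᴹ d} → (∀ i → x i ≈ᴹ y i) →
                       LinearlyIndependent x → LinearlyIndependent y
  independent-resp-≈ x≈y ind c cy≈0 =
    ind c (≈ᴹ-trans (combination-cong (λ _ → Ring.refl R) x≈y) cy≈0)

-- The last hypothesis says that the kernel of `g` lies in that of `f`, so every relation on `g ∘ x`
-- is already one on `f ∘ x`. This carries independence from one module to another.
independent-transfer :
  {R : Ring r ℓr} {V : LeftModule R v ℓv} {W : LeftModule R w ℓw} {W′ : LeftModule R a ℓa} →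
  ∀ {f g} → IsLinear V W f → IsLinear V W′ g →
  (∀ y → LeftModule._≈ᴹ_ W′ (g y) (LeftModule.0ᴹ W′) → LeftModule._≈ᴹ_ W (f y) (LeftModule.0ᴹ W)) →
  ∀ {x : Vector _ d} → LinearAlgebra.LinearlyIndependent W (f ∘ x) →
  LinearAlgebra.LinearlyIndependent W′ (g ∘ x)
independent-transfer {W = W} {W′} f-lin g-lin ker {x} ind c cgx≈0 =
  ind c (W.≈ᴹ-trans (W.≈ᴹ-sym (IsLinear.combination-homo f-lin c x))
          (ker _ (W′.≈ᴹ-trans (IsLinear.combination-homo g-lin c x) cgx≈0)))
  where
  module W = LeftModule W
  module W′ = LeftModule W′

module CommutativeCombination {R : CommutativeRing r ℓr}
                              (V : LeftModule (CommutativeRing.ring R) v ℓv) where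
  open CommutativeRing R using (Carrier; ring; *-comm) renaming (refl to ≈-refl)
  open LeftModule V
  open LinearAlgebra V
  open Combination V
  open CommutativeSum +ᴹ-commutativeMonoid using (sum-cong-≋; ∑-distrib-+)

  -- Commutativity of `R` enters here: `c` has to move past the scalar `c′`. Linearity of
  -- `combination` in its vectors rests on this.
  scaling-isLinear : ∀ c → IsLinear V V (c *ₗ_)
  scaling-isLinear c = isLinear V V *ₗ-congˡ (*ₗ-distribˡ c) λ c′ x →
    ≈ᴹ-trans (≈ᴹ-sym (*ₗ-assoc c c′ x)) (≈ᴹ-trans (*ₗ-congʳ (*-comm c c′)) (*ₗ-assoc c′ c x))

  combination-isLinearʳ : (c : Vector Carrier d) → IsLinear (power V d) V (combination c)
  combination-isLinearʳ c = isLinear (power V _) V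
    (combination-cong λ _ → ≈-refl)
    (λ x y → ≈ᴹ-trans (sum-cong-≋ λ i → *ₗ-distribˡ (c i) (x i) (y i))
      (∑-distrib-+ (λ i → c i *ₗ x i) (λ i → c i *ₗ y i)))
    (λ c′ x → ≈ᴹ-sym (IsLinear.combination-homo (scaling-isLinear c′) c x))

-- Counting vectors over a finite field.

module Finite (F : FiniteField a ℓa q) where
  open FiniteField F hiding (zero) renaming (refl to ≈-refl)
  private
    module card = Inverse cardinality
    F^ = coordinateSpace F

  to-injective : ∀ {x y} → card.to x ≡ card.to y → x ≈ y
  to-injective {x} {y} eq = trans (sym (card.strictlyInverseʳ x))
    (trans (card.from-cong eq) (card.strictlyInverseʳ y))

  from-injective : ∀ {i j} → card.from i ≈ card.from j → i ≡ j
  from-injective {i} {j} eq = ≡.trans (≡.sym (card.strictlyInverseˡ i))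
    (≡.trans (card.to-cong eq) (card.strictlyInverseˡ j))

  _≟_ : Decidable₂ _≈_
  x ≟ y = map′ to-injective card.to-cong (card.to x ≟ᶠ card.to y)

  encode : Vector Carrier d → Fin (q ^ d)
  encode c = funToFin (card.to ∘ c)

  decode : Fin (q ^ d) → Vector Carrier d
  decode i = card.from ∘ finToFun i

  decode-encode : ∀ (c : Vector Carrier d) i → decode (encode c) i ≈ c i
  decode-encode c i = trans (card.from-cong (finToFun-funToFin (card.to ∘ c) i))
                            (card.strictlyInverseʳ (c i))

  encode-injective : {c c′ : Vector Carrier d} → encode c ≡ encode c′ → ∀ i → c i ≈ c′ i
  encode-injective {c = c} {c′} eq i = trans (sym (decode-encode c i))
    (trans (reflexive (cong (λ t → decode t i) eq)) (decode-encode c′ i))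

  decode-injective : {i j : Fin (q ^ d)} → (∀ t → decode i t ≈ decode j t) → i ≡ j
  decode-injective {d = d} eq = finToFun-injective {m = d} (from-injective ∘ eq)

  -- Exhaustive search over the codes in `Fin (q ^ d)`. A vector is recovered from its code only up
  -- to pointwise `≈`, hence the demand that `P` respect it.
  any-vector? : {P : Pred (Vector Carrier d) p} → (∀ {c c′} → (∀ i → c i ≈ c′ i) → P c → P c′) →
                Decidable P → Dec (∃ P)
  any-vector? resp P? = map′
    (λ (i , Pi) → decode i , Pi)
    (λ (c , Pc) → encode c , resp (λ i → sym (decode-encode c i)) Pc)
    (any? (P? ∘ decode))

  *-cancelˡ-0 : ∀ {x y} → ¬ x ≈ 0# → x * y ≈ 0# → y ≈ 0#
  *-cancelˡ-0 {x} {y} x≉0 xy≈0 with inverse x x≉0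
  ... | x⁻¹ , xx⁻¹≈1 = begin
    y               ≈⟨ *-identityˡ y ⟨
    1# * y          ≈⟨ *-congʳ xx⁻¹≈1 ⟨
    x * x⁻¹ * y     ≈⟨ *-congʳ (*-comm x x⁻¹) ⟩
    x⁻¹ * x * y     ≈⟨ *-assoc x⁻¹ x y ⟩
    x⁻¹ * (x * y)   ≈⟨ *-congˡ xy≈0 ⟩
    x⁻¹ * 0#        ≈⟨ zeroʳ x⁻¹ ⟩
    0#              ∎
    where open SetoidReasoning ≈-setoid

  1<q : 1 < q
  1<q = injective⇒≤ {f = f} f-injective
    where
    f : Fin 2 → Fin q
    f zero       = card.to 0#
    f (suc zero) = card.to 1#
    f-injective : Injective _≡_ _≡_ f
    f-injective {zero}     {zero}     _  = refl
    f-injective {zero}     {suc zero} eq = contradiction (sym (to-injective eq)) 1≉0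
    f-injective {suc zero} {zero}     eq = contradiction (to-injective eq) 1≉0
    f-injective {suc zero} {suc zero} _  = refl

  ^-cancelʳ-≤ : q ^ s ≤ q ^ d → s ≤ d
  ^-cancelʳ-≤ q^s≤q^d = ≮⇒≥ λ d<s → <⇒≱ (^-monoʳ-< q 1<q d<s) q^s≤q^d

  -- Distinct coefficient vectors have distinct combinations, so the space of dimension `s` embeds
  -- in that of dimension `d`, and `q ^ s ≤ q ^ d`.
  independent⇒≤ : (x : Vector (Vector Carrier d) s) →
                  LinearAlgebra.LinearlyIndependent (F^ d) x → s ≤ d
  independent⇒≤ {d = d} {s} x ind = ^-cancelʳ-≤ {s} {d} (injective⇒≤ injective)
    where
    open LeftModule (F^ d)
    open LinearAlgebra (F^ d)
    open IsLinear (Combination.combination-isLinearˡ (F^ d) x)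
    difference : ∀ c c′ → combination c x ≈ᴹ combination c′ x → ∀ i → c i - c′ i ≈ 0#
    difference c c′ eq = ind _ (begin
      combination (λ i → c i - c′ i) x                 ≈⟨ +ᴹ-homo c (λ i → - c′ i) ⟩
      combination c x +ᴹ combination (λ i → - c′ i) x  ≈⟨ +ᴹ-cong eq (-ᴹ-homo c′) ⟩
      combination c′ x +ᴹ -ᴹ combination c′ x          ≈⟨ -ᴹ‿inverseʳ (combination c′ x) ⟩
      0ᴹ                                               ∎)
      where open SetoidReasoning ≈ᴹ-setoid
    injective : Injective _≡_ _≡_ (λ i → encode (combination (decode i) x))
    injective {i} {j} eq = decode-injective {d = s} λ t →
      GroupProperties.x∙y⁻¹≈ε⇒x≈y +-group _ _ (difference (decode i) (decode j) (encode-injective eq) t)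

  -- A relation among the coefficient vectors of the `x i` with respect to `y` is also a relation
  -- among the `x i`. These coefficient vectors are therefore independent in dimension `d`.
  Span-independent⇒≤ : {V : LeftModule ring v ℓv} →
    let open LinearAlgebra V in
    ∀ {x : Vector _ s} {y : Vector _ d} → LinearlyIndependent x → (∀ i → x i ∈ Span y) → s ≤ d
  Span-independent⇒≤ {V = V} {y = y} ind x∈ = independent⇒≤ (proj₁ ∘ x∈)
    (independent-transfer {V = F^ _} {W = V} {W′ = F^ _}
      (Combination.combination-isLinearˡ V y)
      (isLinear (F^ _) (F^ _) (λ eq → eq) (λ _ _ _ → ≈-refl) (λ _ _ _ → ≈-refl))
      (λ c c≈0 → LeftModule.≈ᴹ-trans V (IsLinear.⟦⟧-cong (Combination.combination-isLinearˡ V y) c≈0)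
        (Combination.combination-zeroˡ V y))
      (Combination.independent-resp-≈ V (proj₂ ∘ x∈) ind))

  -- Deciding spans and independence, and extracting bases.

  module _ (V : LeftModule ring v ℓv) (_≟ᴹ_ : Decidable₂ (LeftModule._≈ᴹ_ V)) where
    open LeftModule V
    open LinearAlgebra V
    open Combination V
    open SetoidReasoning ≈ᴹ-setoid

    ∈-Span? : (x : Vector Carrierᴹ d) → Decidable (Span x)
    ∈-Span? x y = any-vector?
      (λ c≈c′ y≈ → ≈ᴹ-trans y≈ (combination-cong c≈c′ λ _ → ≈ᴹ-refl))
      λ c → y ≟ᴹ combination c x

    Dependent : Vector Carrierᴹ d → Set _
    Dependent x = ∃ λ c → ¬ (∀ i → c i ≈ 0#) × combination c x ≈ᴹ 0ᴹ

    -- The search yields an actual nonzero relation in the dependent case; later this relation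
    -- itself is used as a vector.
    independent⊎dependent : (x : Vector Carrierᴹ d) → LinearlyIndependent x ⊎ Dependent x
    independent⊎dependent x with any-vector? {P = λ c → ¬ (∀ i → c i ≈ 0#) × combination c x ≈ᴹ 0ᴹ}
      (λ c≈c′ (c≉0 , cx≈0) →
        (λ c′≈0 → c≉0 λ i → trans (c≈c′ i) (c′≈0 i)) ,
        ≈ᴹ-trans (combination-cong (sym ∘ c≈c′) λ _ → ≈ᴹ-refl) cx≈0)
      (λ c → ¬? (all? (λ i → c i ≟ 0#)) ×-dec (combination c x ≟ᴹ 0ᴹ))
    ... | yes dep = inj₂ dep
    ... | no ¬dep = inj₁ λ c cx≈0 → decidable-stable (all? λ i → c i ≟ 0#) λ c≉0 → ¬dep (c , c≉0 , cx≈0)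

    -- A relation whose leading coefficient is nonzero could be solved for `y`, placing it in the
    -- span of `x`.
    ∷-independent : ∀ {x : Vector Carrierᴹ d} {y} → LinearlyIndependent x → ¬ y ∈ Span x →
                    LinearlyIndependent (y ∷ x)
    ∷-independent {x = x} {y} ind y∉ c eq = λ where
        zero    → c₀≈0
        (suc i) → ind (c ∘ suc) tail≈0 i
      where
      open IsLinear (combination-isLinearˡ x)
      ∈-if : ¬ c zero ≈ 0# → y ∈ Span x
      ∈-if c₀≉0 with inverse (c zero) c₀≉0
      ... | u , c₀u≈1 = _ , (begin
        y                                           ≈⟨ *ₗ-identityˡ y ⟨
        1# *ₗ y                                     ≈⟨ *ₗ-congʳ (trans (*-comm u (c zero)) c₀u≈1) ⟨
        (u * c zero) *ₗ y                           ≈⟨ *ₗ-assoc u (c zero) y ⟩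
        u *ₗ c zero *ₗ y                            ≈⟨ *ₗ-congˡ (GroupProperties.inverseˡ-unique +ᴹ-group _ _ eq) ⟩
        u *ₗ -ᴹ combination (c ∘ suc) x             ≈⟨ *ₗ-congˡ (-ᴹ-homo (c ∘ suc)) ⟨
        u *ₗ combination (λ i → - (c (suc i))) x    ≈⟨ *ₗ-homo u (λ i → - (c (suc i))) ⟨
        combination (λ i → u * - (c (suc i))) x     ∎)
      c₀≈0 : c zero ≈ 0#
      c₀≈0 = decidable-stable (c zero ≟ 0#) (y∉ ∘ ∈-if)
      tail≈0 : combination (c ∘ suc) x ≈ᴹ 0ᴹ
      tail≈0 = begin
        combination (c ∘ suc) x                   ≈⟨ +ᴹ-identityˡ _ ⟨
        0ᴹ +ᴹ combination (c ∘ suc) x             ≈⟨ +ᴹ-congʳ (*ₗ-zeroˡ y) ⟨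
        0# *ₗ y +ᴹ combination (c ∘ suc) x        ≈⟨ +ᴹ-congʳ (*ₗ-congʳ c₀≈0) ⟨
        c zero *ₗ y +ᴹ combination (c ∘ suc) x    ≈⟨ eq ⟩
        0ᴹ                                        ∎

    -- A basis is built from the last vector forward: each head is added exactly when it lies
    -- outside the span so far. As rank is a relation, this is what gives every vector a rank.
    Span-hasDimension : (x : Vector Carrierᴹ d) → ∃ (HasDimension (Span x))
    Span-hasDimension {zero}  x = zero , x , record
      { members = λ () ; independent = λ _ _ () ; spanning = λ y∈ → y∈ }
    Span-hasDimension {suc d} x with Span-hasDimension (x ∘ suc)
    ... | s , y , y-basis with ∈-Span? y (x zero)
    ... | yes x₀∈ = s , y , record
      { members     = λ i → Span-mono (x ∘ suc) x (∈-Span x ∘ suc) (members i)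
      ; independent = independent
      ; spanning    = Span-mono x y λ where
          zero    → x₀∈
          (suc i) → spanning (∈-Span (x ∘ suc) i)
      }
      where open IsBasis y-basis
    ... | no x₀∉ = suc s , y′ , record
      { members     = λ where
          zero    → ∈-Span x zero
          (suc i) → Span-mono (x ∘ suc) x (∈-Span x ∘ suc) (members i)
      ; independent = ∷-independent independent x₀∉
      ; spanning    = Span-mono x y′ λ where
          zero    → ∈-Span y′ zero
          (suc i) → Span-mono y y′ (∈-Span y′ ∘ suc) (spanning (∈-Span (x ∘ suc) i))
      }
      where
      open IsBasis y-basis
      y′ = x zero ∷ y

  _≟ⱽ_ : Decidable₂ (LeftModule._≈ᴹ_ (F^ d))
  x ≟ⱽ y = all? λ i → x i ≟ y i

-- Enlarging an independent family of products by a shift of the codeword.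

module RankIncrease {K : FiniteField a ℓa q} {L : FiniteField b ℓb (q ^ m)}
                    (E : Extension K L) where
  private
    module K = FiniteField K
    module L = FiniteField L
    module FK = Finite K
    module FL = Finite L
    L/K = overBase E
    K^ = coordinateSpace K
    L^ = coordinateSpace L
    module L^ {n} = LeftModule (L^ n)

  open LinearAlgebra L/K using (LinearlyIndependent) renaming (combination to dot)
  open Combination L/K
  open CommutativeCombination {R = K.commutativeRing} L/K

  -- Multiplication by `β` is `K`-linear on `L`, so it passes through a combination with
  -- coefficients in `K`. Together with additivity this makes `dot y` linear over all of `L`.
  dot-*ₗ : ∀ (y : Vector K.Carrier n) β v → dot y (β L^.*ₗ v) L.≈ β L.* dot y v
  dot-*ₗ y β v = L.sym (IsLinear.combination-homo β-linear y v)
    where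
    β-linear : IsLinear L/K L/K (β L.*_)
    β-linear = isLinear L/K L/K L.*-congˡ (L.distribˡ β) λ c x → begin
      β L.* (ι c L.* x)     ≈⟨ L.*-assoc β (ι c) x ⟨
      β L.* ι c L.* x       ≈⟨ L.*-congʳ (L.*-comm β (ι c)) ⟩
      ι c L.* β L.* x       ≈⟨ L.*-assoc (ι c) β x ⟩
      ι c L.* (β L.* x)     ∎
      where
      open Extension E
      open SetoidReasoning L.≈-setoid

  dot-+ : ∀ (y : Vector K.Carrier n) v w → dot y (v L^.+ᴹ w) L.≈ dot y v L.+ dot y w
  dot-+ y = IsLinear.+ᴹ-homo (combination-isLinearʳ y)

  dot-isLinear : ∀ (y : Vector K.Carrier n) → IsLinear (L^ n) (TensorUnit.leftModule {R = L.ring}) (dot y)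
  dot-isLinear y = isLinear (L^ _) TensorUnit.leftModule (IsLinear.⟦⟧-cong (combination-isLinearʳ y))
    (dot-+ y) (dot-*ₗ y)

  module _ {v w : Vector L.Carrier n} {y : Vector K.Carrier n} {Y : Vector (Vector K.Carrier n) s}
           (yv≈0 : dot y v L.≈ L.0#) (yw≉0 : ¬ dot y w L.≈ L.0#)
           (Yv-independent : LinearlyIndependent λ i → dot (Y i) v) where

    private
      shifted : L.Carrier → Vector L.Carrier (suc s)
      shifted α i = dot ((y ∷ Y) i) (v L^.+ᴹ α L^.*ₗ w)

    module _ {c : Vector K.Carrier (suc s)} (c≉0 : ¬ (∀ i → c i K.≈ K.0#)) where
      private
        -- The coefficients `c` form a relation among the products of `y ∷ Y` with a vector `u`
        -- exactly when `dot z u` vanishes, so this one vector stands for the whole relation.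
        z : Vector K.Carrier n
        z = LinearAlgebra.combination (K^ n) c (y ∷ Y)

        expand : ∀ u → dot z u L.≈ dot c (λ i → dot ((y ∷ Y) i) u)
        expand u = combination-assoc c (y ∷ Y) u

        relation⇒ : ∀ {α} → dot c (shifted α) L.≈ L.0# → dot z v L.+ α L.* dot z w L.≈ L.0#
        relation⇒ {α} rel = begin
          dot z v L.+ α L.* dot z w           ≈⟨ L.+-congˡ (dot-*ₗ z α w) ⟨
          dot z v L.+ dot z (α L^.*ₗ w)       ≈⟨ dot-+ z v (α L^.*ₗ w) ⟨
          dot z (v L^.+ᴹ α L^.*ₗ w)           ≈⟨ expand _ ⟩
          dot c (shifted α)                   ≈⟨ rel ⟩
          L.0#                                ∎
          where open SetoidReasoning L.≈-setoid

        -- If `dot z w` vanished, the relation would give `dot z v` zero as well. Since `dot y v` is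
        -- zero, independence of the `dot (Y i) v` kills the tail of `c`; then `dot z w` reduces to
        -- the multiple of `dot y w` by `c zero`, which kills the head.
        zw≉0 : ∀ {α} → dot c (shifted α) L.≈ L.0# → ¬ dot z w L.≈ L.0#
        zw≉0 {α} rel zw≈0 = c≉0 λ where
            zero    → c₀≈0
            (suc i) → tail≈0 i
          where
          open SetoidReasoning L.≈-setoid
          open Extension E
          zv≈0 : dot z v L.≈ L.0#
          zv≈0 = begin
            dot z v                        ≈⟨ L.+-identityʳ _ ⟨
            dot z v L.+ L.0#               ≈⟨ L.+-congˡ (L.zeroʳ α) ⟨
            dot z v L.+ α L.* L.0#         ≈⟨ L.+-congˡ (L.*-congˡ zw≈0) ⟨
            dot z v L.+ α L.* dot z w      ≈⟨ relation⇒ rel ⟩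
            L.0#                           ∎
          tail≈0 : ∀ i → c (suc i) K.≈ K.0#
          tail≈0 = Yv-independent (c ∘ suc) (begin
            dot (c ∘ suc) (λ i → dot (Y i) v)                                 ≈⟨ L.+-identityˡ _ ⟨
            L.0# L.+ dot (c ∘ suc) (λ i → dot (Y i) v)                        ≈⟨ L.+-congʳ (L.zeroʳ (ι (c zero))) ⟨
            ι (c zero) L.* L.0# L.+ dot (c ∘ suc) (λ i → dot (Y i) v)         ≈⟨ L.+-congʳ (L.*-congˡ yv≈0) ⟨
            ι (c zero) L.* dot y v L.+ dot (c ∘ suc) (λ i → dot (Y i) v)      ≈⟨ expand v ⟨
            dot z v                                                           ≈⟨ zv≈0 ⟩
            L.0#                                                              ∎)
          c₀yw≈0 : dot y w L.* ι (c zero) L.≈ L.0#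
          c₀yw≈0 = begin
            dot y w L.* ι (c zero)                                            ≈⟨ L.*-comm _ _ ⟩
            ι (c zero) L.* dot y w                                            ≈⟨ L.+-identityʳ _ ⟨
            ι (c zero) L.* dot y w L.+ L.0#
              ≈⟨ L.+-congˡ (combination-zeroˡ (λ i → dot (Y i) w)) ⟨
            ι (c zero) L.* dot y w L.+ dot (λ _ → K.0#) (λ i → dot (Y i) w)
              ≈⟨ L.+-congˡ (combination-cong tail≈0 λ _ → L.refl) ⟨
            dot c (λ i → dot ((y ∷ Y) i) w)                                   ≈⟨ expand w ⟨
            dot z w                                                           ≈⟨ zw≈0 ⟩
            L.0#                                                              ∎
          c₀≈0 : c zero K.≈ K.0#
          -- Injectivity of `ι`: an inverse `u` of `c zero` would turn the vanishing of `ι (c zero)`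
          -- into 1 = 0 in `L`.
          c₀≈0 = decidable-stable (c zero FK.≟ K.0#) λ c₀≉0 →
            let u , c₀u≈1 = K.inverse (c zero) c₀≉0 in L.1≉0 (begin
            L.1#                      ≈⟨ 1#-homo ⟨
            ι K.1#                    ≈⟨ ⟦⟧-cong c₀u≈1 ⟨
            ι (c zero K.* u)          ≈⟨ *-homo (c zero) u ⟩
            ι (c zero) L.* ι u        ≈⟨ L.*-congʳ (FL.*-cancelˡ-0 yw≉0 c₀yw≈0) ⟩
            L.0# L.* ι u              ≈⟨ L.zeroˡ (ι u) ⟩
            L.0#                      ∎)

      -- Both scalars solve the affine equation `dot z v + t * dot z w = 0` in `t`, whose slope is
      -- nonzero.
      relation-determines-scalar : ∀ {α β} → dot c (shifted α) L.≈ L.0# →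
                                   dot c (shifted β) L.≈ L.0# → α L.≈ β
      relation-determines-scalar {α} {β} relα relβ =
        GroupProperties.x∙y⁻¹≈ε⇒x≈y L.+-group α β (FL.*-cancelˡ-0 (zw≉0 relα) (begin
          dot z w L.* (α L.- β)                      ≈⟨ L.*-comm _ _ ⟩
          (α L.- β) L.* dot z w                      ≈⟨ RingProperties.[y-z]x≈yx-zx L.ring (dot z w) α β ⟩
          α L.* dot z w L.- β L.* dot z w            ≈⟨ L.+-congʳ same ⟩
          β L.* dot z w L.- β L.* dot z w            ≈⟨ L.-‿inverseʳ _ ⟩
          L.0#                                       ∎))
        where
        open SetoidReasoning L.≈-setoid
        same : α L.* dot z w L.≈ β L.* dot z w
        same = GroupProperties.∙-cancelˡ L.+-group (dot z v) _ _
          (L.trans (relation⇒ relα) (L.sym (relation⇒ relβ)))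

    -- If every scalar failed, choosing a nonzero relation for each would embed the `q ^ m` scalars
    -- into the nonzero vectors of length `suc s`, of which there are fewer.
    increase : s < m → ∃ λ α → LinearlyIndependent λ i → dot ((y ∷ Y) i) (v L^.+ᴹ α L^.*ₗ w)
    increase s<m with any? (independent? ∘ Inverse.from L.cardinality)
      where
      independent? : Decidable (LinearlyIndependent ∘ shifted)
      independent? α with FK.independent⊎dependent L/K FL._≟_ (shifted α)
      ... | inj₁ ind             = yes ind
      ... | inj₂ (c , c≉0 , rel) = no λ ind → c≉0 (ind c rel)
    ... | yes (i , ind) = _ , ind
    ... | no ¬ind = contradiction (^-monoʳ-≤ q {{>-nonZero (<⇒≤ FK.1<q)}} s<m) (<⇒≱ (injective⇒≤ code-injective))
      where
      scalar : Fin (q ^ m) → L.Carrier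
      scalar = Inverse.from L.cardinality
      dependent : ∀ i → FK.Dependent L/K FL._≟_ (shifted (scalar i))
      dependent i with FK.independent⊎dependent L/K FL._≟_ (shifted (scalar i))
      ... | inj₁ ind = contradiction (i , ind) ¬ind
      ... | inj₂ dep = dep
      c : Fin (q ^ m) → Vector K.Carrier (suc s)
      c i = proj₁ (dependent i)
      c≉0 : ∀ i → ¬ (∀ t → c i t K.≈ K.0#)
      c≉0 i = proj₁ (proj₂ (dependent i))
      relation : ∀ i → dot (c i) (shifted (scalar i)) L.≈ L.0#
      relation i = proj₂ (proj₂ (dependent i))
      0ⱽ : Vector K.Carrier (suc s)
      0ⱽ _ = K.0#
      -- The zero vector is adjoined to the chosen nonzero relations. The extra element makes the
      -- inequality strict, which settles the case `suc s = m`.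
      code : Fin (suc (q ^ m)) → Fin (q ^ suc s)
      code zero    = FK.encode 0ⱽ
      code (suc i) = FK.encode (c i)
      code-injective : Injective _≡_ _≡_ code
      code-injective {zero}  {zero}  _  = refl
      code-injective {zero}  {suc j} eq =
        contradiction (K.sym ∘ FK.encode-injective {c = 0ⱽ} {c′ = c j} eq) (c≉0 j)
      code-injective {suc i} {zero}  eq =
        contradiction (FK.encode-injective {c = c i} {c′ = 0ⱽ} eq) (c≉0 i)
      code-injective {suc i} {suc j} eq = cong suc (FL.from-injective
        (relation-determines-scalar (c≉0 i) (relation i)
          (L.trans (combination-cong {x = shifted (scalar j)}
                     (FK.encode-injective {c = c i} {c′ = c j} eq) λ _ → L.refl)
            (relation j))))

-- Rank supports, annihilators and the maximum rank of a code.

module MaximumRank {K : FiniteField a ℓa q} {L : FiniteField b ℓb (q ^ m)}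
                   {E : Extension K L} (Γ : OrderedBasis E m) (C : Code L n k p) where
  private
    module K = FiniteField K
    module L = FiniteField L
    module FK = Finite K
    module FL = Finite L
    L/K = overBase E
    K^ = coordinateSpace K
    L^ = coordinateSpace L
    K¹ = TensorUnit.leftModule {R = K.ring}
    module L^ {n} = LeftModule (L^ n)
    module LA = LinearAlgebra

  open OrderedBasis Γ
  open RankMetric Γ
  open RankIncrease {m = m} E
  open Code C
  open LinearAlgebra L/K using () renaming (combination to dot)
  open LinearAlgebra K¹ using () renaming (combination to pair)
  open CommutativeCombination {R = K.commutativeRing} K¹
  private module ΓB = LinearAlgebra.IsBasis isBasis

  columns : Vector L.Carrier n → Vector (Vector K.Carrier n) m
  columns v j i = coordinates v i j

  -- The triple product of `y`, the coordinate matrix of `v` and `γ`, bracketed both ways. Since `γ`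
  -- is a basis, `y` annihilates `v` exactly when it is orthogonal to every column.
  dot-expand : ∀ y v → dot y v L.≈ LA.combination L/K (λ j → pair y (columns v j)) γ
  dot-expand y v = begin
    dot y v
      ≈⟨ Combination.combination-cong L/K {c = y} (λ _ → K.refl) (λ i → proj₂ (ΓB.spanning {x = v i} _)) ⟩
    dot y (λ i → LA.combination L/K (coordinates v i) γ)
      ≈⟨ Combination.combination-assoc L/K y (coordinates v) γ ⟨
    LA.combination L/K (LA.combination (K^ m) y (coordinates v)) γ
      ≈⟨ Combination.combination-cong L/K (λ j → IsLinear.combination-homo
           (Combination.evaluation-isLinear K¹ j) y (coordinates v)) (λ _ → L.refl) ⟩
    LA.combination L/K (λ j → pair y (columns v j)) γ ∎
    where open SetoidReasoning L.≈-setoid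

  dot≈0⇒pair≈0 : ∀ {y v} → dot y v L.≈ L.0# → ∀ j → pair y (columns v j) K.≈ K.0#
  dot≈0⇒pair≈0 {y} {v} yv≈0 = ΓB.independent _ (L.trans (L.sym (dot-expand y v)) yv≈0)

  pair≈0⇒dot≈0 : ∀ {y v} → (∀ j → pair y (columns v j) K.≈ K.0#) → dot y v L.≈ L.0#
  pair≈0⇒dot≈0 {y} {v} pair≈0 = L.trans (dot-expand y v)
    (L.trans (Combination.combination-cong L/K pair≈0 (λ _ → L.refl))
      (Combination.combination-zeroˡ L/K γ))

  pair-Span≈0 : ∀ {y} {x : Vector (Vector K.Carrier n) d} → (∀ j → pair y (x j) K.≈ K.0#) →
                ∀ {z} → z ∈ LA.Span (K^ n) x → pair y z K.≈ K.0#
  pair-Span≈0 {y = y} {x} yx≈0 {z} (c , z≈) = begin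
    pair y z                                  ≈⟨ IsLinear.⟦⟧-cong (combination-isLinearʳ y) z≈ ⟩
    pair y (LA.combination (K^ n) c x)        ≈⟨ IsLinear.combination-homo (combination-isLinearʳ y) c x ⟩
    pair c (λ j → pair y (x j))               ≈⟨ IsLinear.⟦⟧-cong (combination-isLinearʳ c) yx≈0 ⟩
    pair c (λ _ → K.0#)                       ≈⟨ IsLinear.0ᴹ-homo (combination-isLinearʳ c) ⟩
    K.0#                                      ∎
    where open SetoidReasoning K.≈-setoid

  -- Such a `y` is orthogonal to the rank support of each codeword, hence to their sum, which is the
  -- whole space; pairing with the standard basis reads off the entries of `y`.
  nondegenerate⇒separating : Nondegenerate C → ∀ {y} → (∀ {w} → w ∈ Codeword → dot y w L.≈ L.0#) →
                             ∀ i → y i K.≈ K.0#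
  nondegenerate⇒separating nondeg {y} y⊥C i = begin
    y i                  ≈⟨ Combination.combination-δ K¹ i y ⟨
    pair (δ K.ring i) y  ≈⟨ sum-cong (λ j → K.*-comm (δ K.ring i j) (y j)) ⟩
    pair y (δ K.ring i)  ≈⟨ pair≈0 (nondeg (δ K.ring i)) ⟩
    K.0#                 ∎
    where
    open SetoidReasoning K.≈-setoid
    open CommutativeSum K.+-commutativeMonoid using () renaming (sum-cong-≋ to sum-cong)
    open CommutativeSum (LeftModule.+ᴹ-commutativeMonoid (K^ n)) using (sum)
    pair-sum≈0 : ∀ {d} (x : Vector (Vector K.Carrier n) d) → (∀ t → pair y (x t) K.≈ K.0#) →
                 pair y (sum x) K.≈ K.0#
    pair-sum≈0 {zero}  x yx≈0 = IsLinear.0ᴹ-homo (combination-isLinearʳ y)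
    pair-sum≈0 {suc d} x yx≈0 = K.trans (IsLinear.+ᴹ-homo (combination-isLinearʳ y) (x zero) (sum (x ∘ suc)))
      (K.trans (K.+-cong (yx≈0 zero) (pair-sum≈0 (x ∘ suc) (yx≈0 ∘ suc))) (K.+-identityˡ K.0#))
    pair≈0 : ∀ {z} → z ∈ codeRankSupport C → pair y z K.≈ K.0#
    pair≈0 (_ , w , x , x∈ , z≈) = K.trans (IsLinear.⟦⟧-cong (combination-isLinearʳ y) z≈)
      (pair-sum≈0 x λ t → pair-Span≈0 (dot≈0⇒pair≈0 (y⊥C (proj₂ (w t)))) (x∈ t))

  detecting-codeword : Nondegenerate C → ∀ {y} → ¬ (∀ i → y i K.≈ K.0#) →
                       ∃ λ w → w ∈ Codeword × ¬ dot y w L.≈ L.0#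
  detecting-codeword nondeg {y} y≉0
    with g , g-basis ← hasDimension
    -- By `L`-linearity of `dot y`, testing the `k` basis codewords suffices, so the search for a
    -- witness is finite.
    with all? (λ t → dot y (g t) FL.≟ L.0#)
  ... | yes yg≈0 = contradiction (nondegenerate⇒separating nondeg y⊥C) y≉0
    where
    open LinearAlgebra.IsBasis g-basis
    L¹ = TensorUnit.leftModule {R = L.ring}
    y⊥C : ∀ {w} → w ∈ Codeword → dot y w L.≈ L.0#
    y⊥C {w} w∈ with c , w≈ ← spanning w∈ = begin
      dot y w                                   ≈⟨ IsLinear.⟦⟧-cong (dot-isLinear y) w≈ ⟩
      dot y (LA.combination (L^ n) c g)         ≈⟨ IsLinear.combination-homo (dot-isLinear y) c g ⟩
      LA.combination L¹ c (λ t → dot y (g t))   ≈⟨ IsLinear.⟦⟧-cong (c-linear c) yg≈0 ⟩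
      LA.combination L¹ c (λ _ → L.0#)          ≈⟨ IsLinear.0ᴹ-homo (c-linear c) ⟩
      L.0#                                      ∎
      where
      open SetoidReasoning L.≈-setoid
      c-linear : ∀ c → IsLinear (L^ k) L¹ (LA.combination L¹ c)
      c-linear = CommutativeCombination.combination-isLinearʳ {R = L.commutativeRing} L¹
  ... | no yg≉0 with t , ygt≉0 ← ¬∀⟶∃¬ k _ (λ t → dot y (g t) FL.≟ L.0#) yg≉0 =
    g t , LinearAlgebra.IsBasis.members g-basis t , ygt≉0

  -- The rank of v is the K-dimension of the span of its entries; each dot (Y i) v lies in it.
  RankAtLeast : Vector L.Carrier n → ℕ → Set _
  RankAtLeast v s = ∃ λ (Y : Vector (Vector K.Carrier n) s) →
    LA.LinearlyIndependent L/K λ i → dot (Y i) v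

  -- Each `Y i` is sent to its pairings with the `d` basis vectors of the rank support. A vector
  -- whose pairings all vanish annihilates `v`, so independence transfers to these vectors of length
  -- `d`.
  rankAtLeast⇒≤ : ∀ {v} → RankAtLeast v s → HasRank v d → s ≤ d
  rankAtLeast⇒≤ {v = v} (Y , ind) (x , x-basis) = FK.independent⇒≤ (λ i t → pair (Y i) (x t))
    (independent-transfer {V = K^ n} {W = L/K} {W′ = K^ _} {f = λ y → dot y v} {g = λ y t → pair y (x t)}
      (Combination.combination-isLinearˡ L/K v)
      (isLinear (K^ n) (K^ _)
        (λ y≈ t → IsLinear.⟦⟧-cong (lin t) y≈)
        (λ y y′ t → IsLinear.+ᴹ-homo (lin t) y y′)
        (λ c y t → IsLinear.*ₗ-homo (lin t) c y))
      (λ y yx≈0 → pair≈0⇒dot≈0 λ j → pair-Span≈0 yx≈0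
        (spanning (Combination.∈-Span (K^ n) (columns v) j)))
      ind)
    where
    open LinearAlgebra.IsBasis x-basis
    lin : ∀ t → IsLinear (K^ n) K¹ λ y → pair y (x t)
    lin t = Combination.combination-isLinearˡ K¹ (x t)

  -- Induction on `s`. The conclusion allows any `r` from `s` upward because a codeword with
  -- independent entries jumps straight to `n`.
  ∃-rankAtLeast : Nondegenerate C → ∀ s → s ≤ n → s ≤ m →
                  ∃ λ r → s ≤ r × ∃ λ v → v ∈ Codeword × RankAtLeast v r
  ∃-rankAtLeast nondeg zero    _   _   = zero , z≤n , L^.0ᴹ , 0-closed , (λ ()) , λ _ _ ()
    where open LinearAlgebra.IsSubspace isSubspace
  ∃-rankAtLeast nondeg (suc s) s<n s<m
    with ∃-rankAtLeast nondeg s (<⇒≤ s<n) (<⇒≤ s<m)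
  ... | r , s≤r , v , v∈ , Y , Y-ind with m≤n⇒m<n∨m≡n s≤r
  ... | inj₁ s<r  = r , s<r , v , v∈ , Y , Y-ind
  ... | inj₂ refl with FK.independent⊎dependent L/K FL._≟_ v
  -- The products of `v` with the standard basis are its entries.
  ... | inj₁ v-ind = n , s<n , v , v∈ , δ K.ring ,
    Combination.independent-resp-≈ L/K (λ i → L.sym (Combination.combination-δ L/K i v)) v-ind
  -- A dependence among the entries of `v` is a nonzero `y` annihilating `v`.
  ... | inj₂ (y , y≉0 , yv≈0) with w , w∈ , yw≉0 ← detecting-codeword nondeg y≉0
    with α , ind ← increase {v = v} {w} {y} {Y} yv≈0 yw≉0 Y-ind s<m =
    suc s , ≤-refl , _ , +-closed v∈ (*ₗ-closed α w∈) , y ∷ Y , ind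
    where open LinearAlgebra.IsSubspace isSubspace

  -- The rank support lies in a space of dimension `n` and is spanned by `m` columns.
  rank-upper-bound : ∀ {v} → HasRank v d → d ≤ n ⊓ m
  rank-upper-bound (x , x-basis) = ⊓-glb (FK.independent⇒≤ x independent)
    (FK.Span-independent⇒≤ {V = K^ n} independent members)
    where open LinearAlgebra.IsBasis x-basis

  nondegenerate⇒isMaximumRank : Nondegenerate C → IsMaximumRank C (n ⊓ m)
  nondegenerate⇒isMaximumRank nondeg
    with ∃-rankAtLeast nondeg (n ⊓ m) (m⊓n≤m n m) (m⊓n≤n n m)
  ... | _ , n⊓m≤r , v , v∈ , r≤v
    with d , rk ← FK.Span-hasDimension (K^ n) FK._≟ⱽ_ (columns v) =
    -- The actual rank `d` of `v` is squeezed: the independent products bound it from below, the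
    -- shape of the matrix from above.
    (v , v∈ , subst (HasRank v)
      (≤-antisym (rank-upper-bound rk) (≤-trans n⊓m≤r (rankAtLeast⇒≤ r≤v rk))) rk) ,
    λ (_ , _ , rk′) → rank-upper-bound rk′

  -- A vector outside the rank support of `v` would extend its basis to `suc n` independent vectors
  -- of length `n`. That support alone is thus everything.
  full-rank⇒nondegenerate : ∀ {v} → v ∈ Codeword → HasRank v n → Nondegenerate C
  full-rank⇒nondegenerate {v} v∈ (x , x-basis) z with FK.∈-Span? (K^ n) FK._≟ⱽ_ x z
  -- `z` is written as a sum with one term, drawn from the support of `v`.
  ... | yes z∈ = 1 , (λ _ → v , v∈) , (λ _ → z) ,
    (λ _ → Combination.Span-mono (K^ n) x (columns v) members z∈) , λ i → K.sym (K.+-identityʳ (z i))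
    where open LinearAlgebra.IsBasis x-basis
  ... | no z∉ = contradiction
    (FK.independent⇒≤ (z ∷ x) (FK.∷-independent (K^ n) FK._≟ⱽ_ independent z∉)) (<⇒≱ (n<1+n n))
    where open LinearAlgebra.IsBasis x-basis

proposition3p11 : {a ℓa b ℓb p : Level} {q n m k : ℕ} →
    IsPrimePower q → 0 < n → 0 < m → 0 < k →
    (K : FiniteField a ℓa q) (L : FiniteField b ℓb (q ^ m)) →
    (E : Extension K L) (Γ : OrderedBasis E m) →
    (C : Code L n k p) →
    (RankMetric.Nondegenerate Γ C → RankMetric.IsMaximumRank Γ C (n ⊓ m))
    × (n ≡ m → RankMetric.Nondegenerate Γ C ⇔ RankMetric.IsMaximumRank Γ C n)
proposition3p11 {n = n} _ _ _ _ K L E Γ C =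
  nondegenerate⇒isMaximumRank ,
  λ where
    refl → mk⇔
      (λ nondeg → subst (RankMetric.IsMaximumRank Γ C) (⊓-idem n) (nondegenerate⇒isMaximumRank nondeg))
      (λ ((_ , v∈ , rk) , _) → full-rank⇒nondegenerate v∈ rk)
  where open MaximumRank Γ C
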